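{- Let $m,\lambda,k\geq 1$ be integers and let $L$ be a Latin square of order $m$. If $L$ has a $k$-plex and $k$ divides $\lambda$, then $L(\lambda)$ has a balanced diagonal. In particular, if $L$ has a transversal, then $L(\lambda)$ has a balanced diagonal for every integer $\lambda\geq 1$.
   Context: A Latin square of order $m$ is an $m\times m$ array with entries from $\{1,\dots,m\}$ in which each symbol occurs exactly once in each row and each column. A frequency square of type $F(m\lambda;\lambda^m)$ is an $m\lambda\times m\lambda$ array with entries from $\{1,\dots,m\}$ in which each symbol occurs exactly $\lambda$ times in each row and exactly $\lambda$ times in each column. Given a Latin square $L$ of order $m$, $L(\lambda)$ is the frequency square of type $F(m\lambda;\lambda^m)$ obtained by replacing each cell of $L$ containing entry $e$ with a $\lambda\times\lambda$ block of $e$'s; that is, the entry of $L(\lambda)$ in cell $(i,j)$ is $L_{\lceil i/\lambda\rceil,\lceil j/\lambda\rceil}$. A $k$-plex in a Latin square is a subset of its cells in which each row, each column and each entry is represented exactly $k$ times; a transversal is a $1$-plex. A diagonal of a square array is a set of cells that uses each row and each column exactly once. A diagonal of a frequency square of type $F(m\lambda;\lambda^m)$ is balanced if each symbol in $\{1,\dots,m\}$ occurs in exactly $\lambda$ of its cells. -}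

module Defs where

open import Data.Bool.Base using (Bool)
open import Data.Bool.Properties using (T?)
open import Data.Fin.Base using (Fin; zero; suc; quotient; _↑ˡ_; _↑ʳ_)
open import Data.Fin.Properties using (_≟_; splitAt-↑ˡ; splitAt-↑ʳ)
open import Data.List.Base using (length; filter; allFin; tabulate; cartesianProduct)
open import Data.Nat.Base using (ℕ; zero; suc; _+_; _*_)
open import Data.Nat.Properties using (*-identityˡ)
open import Data.Product.Base using (∃-syntax; _×_; proj₁; proj₂; uncurry)
open import Function.Base using (_∘_; id)
open import Level using (0ℓ)
open import Relation.Binary.PropositionalEquality
  using (_≡_; refl; cong; module ≡-Reasoning)
open import Relation.Nullary.Decidable using (yes; no; _×-dec_)
open import Relation.Nullary.Negation using (¬_)
open import Relation.Unary using (Pred; Decidable)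

countFin : ∀ {n} {P : Pred (Fin n) 0ℓ} → Decidable P → ℕ
countFin {n} P? = length (filter P? (allFin n))

record LatinSquare (m : ℕ) : Set where
  field
    entry    : Fin m → Fin m → Fin m
    rowCount : ∀ r e → countFin (λ c → entry r c ≟ e) ≡ 1
    colCount : ∀ c e → countFin (λ r → entry r c ≟ e) ≡ 1

-- Frequency squares of type F(mℓ; ℓᵐ).
record FrequencySquare (m ℓ : ℕ) : Set where
  field
    entry    : Fin (m * ℓ) → Fin (m * ℓ) → Fin m
    rowCount : ∀ r e → countFin (λ c → entry r c ≟ e) ≡ ℓ
    colCount : ∀ c e → countFin (λ r → entry r c ≟ e) ≡ ℓ

private
  countTab : ∀ {A : Set} {P : Pred A 0ℓ} → Decidable P → ∀ {n} → (Fin n → A) → ℕ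
  countTab P? f = length (filter P? (tabulate f))

  countTab-∘ : ∀ {A B : Set} {P : Pred B 0ℓ} (P? : Decidable P) (h : A → B)
               {n} (f : Fin n → A) (g : Fin n → B) → (∀ i → h (f i) ≡ g i) →
               countTab (λ a → P? (h a)) f ≡ countTab P? g
  countTab-∘ P? h {zero}  f g eq = refl
  countTab-∘ P? h {suc n} f g eq rewrite eq zero with P? (g zero)
  ... | yes _ = cong suc (countTab-∘ P? h (f ∘ suc) (g ∘ suc) (eq ∘ suc))
  ... | no  _ = countTab-∘ P? h (f ∘ suc) (g ∘ suc) (eq ∘ suc)

  countTab-cong : ∀ {A : Set} {P : Pred A 0ℓ} (P? : Decidable P) {n} {f g : Fin n → A} →
                  (∀ i → f i ≡ g i) → countTab P? f ≡ countTab P? g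
  countTab-cong P? {f = f} {g} = countTab-∘ P? id f g

  countTab-+ : ∀ {A : Set} {P : Pred A 0ℓ} (P? : Decidable P) a {b} (f : Fin (a + b) → A) →
               countTab P? f ≡ countTab P? (f ∘ (_↑ˡ b)) + countTab P? (f ∘ (a ↑ʳ_))
  countTab-+ P? zero    f = refl
  countTab-+ P? (suc a) f with P? (f zero)
  ... | yes _ = cong suc (countTab-+ P? a (f ∘ suc))
  ... | no  _ = countTab-+ P? a (f ∘ suc)

  quotient-↑ˡ : ∀ {m} ℓ (i : Fin ℓ) → quotient {suc m} ℓ (i ↑ˡ (m * ℓ)) ≡ zero
  quotient-↑ˡ {m} ℓ i rewrite splitAt-↑ˡ ℓ i (m * ℓ) = refl

  quotient-↑ʳ : ∀ {m} ℓ (i : Fin (m * ℓ)) → quotient {suc m} ℓ (ℓ ↑ʳ i) ≡ suc (quotient ℓ i)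
  quotient-↑ʳ {m} ℓ i rewrite splitAt-↑ʳ ℓ (m * ℓ) i = refl

  countTab-const-yes : ∀ {A : Set} {P : Pred A 0ℓ} (P? : Decidable P) n {x : A} → P x →
                       countTab P? {n} (λ _ → x) ≡ n
  countTab-const-yes P? zero px = refl
  countTab-const-yes P? (suc n) {x} px with P? x
  ... | yes _   = cong suc (countTab-const-yes P? n px)
  ... | no  ¬px with () ← ¬px px

  countTab-const-no : ∀ {A : Set} {P : Pred A 0ℓ} (P? : Decidable P) n {x : A} → ¬ P x →
                      countTab P? {n} (λ _ → x) ≡ 0
  countTab-const-no P? zero ¬px = refl
  countTab-const-no P? (suc n) {x} ¬px with P? x
  ... | yes px with () ← ¬px px
  ... | no  _  = countTab-const-no P? n ¬px

  countTab-quotient : ∀ {A : Set} {P : Pred A 0ℓ} (P? : Decidable P) {m} ℓ (g : Fin m → A) →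
                      countTab P? (g ∘ quotient ℓ) ≡ countTab P? g * ℓ
  countTab-quotient P? {zero}  ℓ g = refl
  countTab-quotient P? {suc m} ℓ g
    rewrite countTab-+ P? ℓ (g ∘ quotient {suc m} ℓ)
          | countTab-cong P? (cong g ∘ quotient-↑ˡ {m} ℓ)
          | countTab-cong P? (cong g ∘ quotient-↑ʳ {m} ℓ)
          | countTab-quotient P? ℓ (g ∘ suc)
    with P? (g zero)
  ... | yes p = cong (_+ countTab P? (g ∘ suc) * ℓ) (countTab-const-yes P? ℓ p)
  ... | no ¬p = cong (_+ countTab P? (g ∘ suc) * ℓ) (countTab-const-no P? ℓ ¬p)

  countFin-quotient : ∀ {m} ℓ (f : Fin m → Fin m) e → countFin (λ i → f i ≟ e) ≡ 1 →
                      countFin (λ i → f (quotient ℓ i) ≟ e) ≡ ℓ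
  countFin-quotient {m} ℓ f e once = begin
    countFin (λ i → f (quotient ℓ i) ≟ e)  ≡⟨ countTab-∘ (_≟ e) (f ∘ quotient ℓ) id _ (λ _ → refl) ⟩
    countTab (_≟ e) (f ∘ quotient ℓ)       ≡⟨ countTab-quotient (_≟ e) ℓ f ⟩
    countTab (_≟ e) f * ℓ                  ≡⟨ cong (_* ℓ) (countTab-∘ (_≟ e) f id f (λ _ → refl)) ⟨
    countFin (λ i → f i ≟ e) * ℓ           ≡⟨ cong (_* ℓ) once ⟩
    1 * ℓ                                  ≡⟨ *-identityˡ ℓ ⟩
    ℓ                                      ∎
    where open ≡-Reasoning

-- With indices starting at 0, ⌈i/ℓ⌉ becomes the integer quotient of i by ℓ.
_⟨_⟩ : ∀ {m} → LatinSquare m → (ℓ : ℕ) → FrequencySquare m ℓ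
L ⟨ ℓ ⟩ = record
  { entry    = λ i j → entry (quotient ℓ i) (quotient ℓ j)
  ; rowCount = λ i e → countFin-quotient ℓ (entry (quotient ℓ i)) e (rowCount (quotient ℓ i) e)
  ; colCount = λ j e → countFin-quotient ℓ (λ r → entry r (quotient ℓ j)) e (colCount (quotient ℓ j) e)
  }
  where open LatinSquare L

Cell : ℕ → Set
Cell n = Fin n × Fin n

CellSet : ℕ → Set
CellSet n = Cell n → Bool

-- The number of cells of S that satisfy P.
countIn : ∀ {n} {P : Pred (Cell n) 0ℓ} → CellSet n → Decidable P → ℕ
countIn {n} S P? =
  length (filter (λ x → T? (S x) ×-dec P? x) (cartesianProduct (allFin n) (allFin n)))

record IsPlex {m} (L : LatinSquare m) (k : ℕ) (S : CellSet m) : Set where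
  open LatinSquare L
  field
    rows    : ∀ r → countIn S (λ x → proj₁ x ≟ r) ≡ k
    columns : ∀ c → countIn S (λ x → proj₂ x ≟ c) ≡ k
    entries : ∀ e → countIn S (λ x → uncurry entry x ≟ e) ≡ k

IsTransversal : ∀ {m} → LatinSquare m → CellSet m → Set
IsTransversal L = IsPlex L 1

record IsDiagonal {n} (S : CellSet n) : Set where
  field
    rows    : ∀ r → countIn S (λ x → proj₁ x ≟ r) ≡ 1
    columns : ∀ c → countIn S (λ x → proj₂ x ≟ c) ≡ 1

IsBalanced : ∀ {m ℓ} → FrequencySquare m ℓ → CellSet (m * ℓ) → Set
IsBalanced {ℓ = ℓ} F S = ∀ e → countIn S (λ x → uncurry entry x ≟ e) ≡ ℓ
  where open FrequencySquare F

HasPlex : ∀ {m} → LatinSquare m → ℕ → Set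
HasPlex L k = ∃[ S ] IsPlex L k S

HasTransversal : ∀ {m} → LatinSquare m → Set
HasTransversal L = ∃[ S ] IsTransversal L S

HasBalancedDiagonal : ∀ {m ℓ} → FrequencySquare m ℓ → Set
HasBalancedDiagonal F = ∃[ S ] IsDiagonal S × IsBalanced F S

{-# OPTIONS --safe #-}
module Submission where

-- The matrix N with entry ℓ / k on the cells of the k-plex and 0 elsewhere has all line sums ℓ.
-- A vector of natural numbers with sum ℓ is a sum of ℓ vectors with sum 1.  Splitting every row
-- of N in this way, and then every column of the result, gives an mℓ × mℓ matrix with all line
-- sums 1, that is, a permutation matrix, whose ℓ × ℓ blocks sum to the entries of N.

open import Data.Bool.Base using (Bool; true; false; _∧_)
open import Data.Fin.Base using (Fin; zero; suc; quotient; remainder; combine; _↑ˡ_; _↑ʳ_)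
open import Data.Fin.Properties using (_≟_; remQuot-combine)
open import Data.List.Base using (length; filter; tabulate; map; cartesianProduct; _++_)
open import Data.List.Properties using (filter-++; length-++; map-tabulate)
open import Data.Nat.Base using (ℕ; zero; suc; _+_; _*_; _≤_; _<ᵇ_; z≤n; s≤s)
open import Data.Nat.Divisibility using (_∣_; divides; 1∣_)
open import Data.Nat.Properties
  using (+-*-semiring; +-assoc; +-identityʳ; *-assoc; *-identityˡ; *-identityʳ; *-zeroʳ;
         m≤m+n; m≤n+m; ≤-trans; ≤-reflexive; n≤0⇒n≡0; suc-injective)
open import Data.Product.Base using (_×_; _,_; proj₁; proj₂; ∃-syntax; uncurry)
open import Data.Vec.Functional using (Vector; _∷_; tail)
open import Function.Base using (_∘_; id; flip)
open import Level using (0ℓ)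
open import Relation.Binary.PropositionalEquality
  using (_≡_; refl; sym; trans; cong; cong₂; module ≡-Reasoning)
open import Relation.Nullary.Decidable using (does)
open import Relation.Unary using (Pred; Decidable)
open import Algebra.Properties.Semiring.Sum +-*-semiring
  using (sum; sum-syntax; sum-cong-≗; sum-replicate-zero; ∑-comm; *-distribˡ-sum; *-distribʳ-sum)
open import Defs

open ≡-Reasoning

∑∑-cong : ∀ {m n} {f g : Fin m → Fin n → ℕ} → (∀ i j → f i j ≡ g i j) →
          ∑[ i < m ] ∑[ j < n ] f i j ≡ ∑[ i < m ] ∑[ j < n ] g i j
∑∑-cong eq = sum-cong-≗ (sum-cong-≗ ∘ eq)

≤-sum : ∀ {n} (v : Vector ℕ n) i → v i ≤ sum v
≤-sum v zero    = m≤m+n (v zero) _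
≤-sum v (suc i) = ≤-trans (≤-sum (tail v) i) (m≤n+m _ (v zero))

sum-+ : ∀ a {b} (f : Fin (a + b) → ℕ) →
        sum f ≡ ∑[ i < a ] f (i ↑ˡ b) + ∑[ j < b ] f (a ↑ʳ j)
sum-+ zero    f = refl
sum-+ (suc a) f = trans (cong (f zero +_) (sum-+ a (tail f))) (sym (+-assoc (f zero) _ _))

-- Peels off the first block: `combine zero t` and `combine (suc r) t` compute to the left and right
-- injections into `ℓ + m * ℓ`.
sum-combine : ∀ {m} ℓ (f : Fin (m * ℓ) → ℕ) →
              sum f ≡ ∑[ r < m ] ∑[ t < ℓ ] f (combine r t)
sum-combine {zero}  ℓ f = refl
sum-combine {suc m} ℓ f =
  trans (sum-+ ℓ f) (cong (∑[ t < ℓ ] f (t ↑ˡ m * ℓ) +_) (sum-combine {m} ℓ (f ∘ (ℓ ↑ʳ_))))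

-- The unit is taken from the first nonzero coordinate, which exists because the sum is positive.
split-unit : ∀ {n s} (v : Vector ℕ n) → sum v ≡ suc s →
             ∃[ u ] ∃[ v′ ] sum u ≡ 1 × sum v′ ≡ s × (∀ i → u i + v′ i ≡ v i)
split-unit {suc n} v eq with v zero in v₀
... | suc a = 1 ∷ (λ _ → 0) , a ∷ tail v
            , cong suc (sum-replicate-zero n) , suc-injective eq
            , λ { zero → sym v₀ ; (suc i) → refl }
... | zero with u , v′ , ∑u , ∑v′ , u+v′ ← split-unit (tail v) eq
            = 0 ∷ u , 0 ∷ v′ , ∑u , ∑v′ , λ { zero → sym v₀ ; (suc i) → u+v′ i }

split-units : ∀ {n} s (v : Vector ℕ n) → sum v ≡ s →
              ∃[ w ] (∀ t → sum (w t) ≡ 1) × (∀ i → ∑[ t < s ] w t i ≡ v i)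
split-units zero v eq =
  -- Each entry is bounded by the total, here 0, so the empty sum of units is already `v`.
  (λ ()) , (λ ()) , λ i → sym (n≤0⇒n≡0 (≤-trans (≤-sum v i) (≤-reflexive eq)))
split-units (suc s) v eq =
  let u , v′ , ∑u , ∑v′ , u+v′ = split-unit v eq
      w , ∑w , w≡v′ = split-units s v′ ∑v′
  in u ∷ w , (λ { zero → ∑u ; (suc t) → ∑w t })
           , λ i → trans (cong (u i +_) (w≡v′ i)) (u+v′ i)

-- A record rather than a bare function type, so that `v̂` and `v` can be inferred from a proof.
record Refines {m} ℓ (v̂ : Vector ℕ (m * ℓ)) (v : Vector ℕ m) : Set where
  constructor refines
  field
    block-sum : ∀ r → ∑[ t < ℓ ] v̂ (combine r t) ≡ v r

open Refines

refines-sum : ∀ {m ℓ} {v̂ : Vector ℕ (m * ℓ)} {v : Vector ℕ m} → Refines ℓ v̂ v → sum v̂ ≡ sum v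
refines-sum {m} {ℓ} {v̂} ref = trans (sum-combine {m} ℓ v̂) (sum-cong-≗ (block-sum ref))

-- The weight is constant on each block, so it factors out of the block sum.
refines-* : ∀ {m ℓ} {v̂ : Vector ℕ (m * ℓ)} {v : Vector ℕ m} → Refines ℓ v̂ v → (g : Vector ℕ m) →
            Refines ℓ (λ x → v̂ x * g (quotient ℓ x)) (λ r → v r * g r)
refines-* {ℓ = ℓ} {v̂} {v} ref g = refines λ r → begin
  ∑[ t < ℓ ] (v̂ (combine r t) * g (quotient ℓ (combine r t)))
    ≡⟨ sum-cong-≗ (λ t → cong (λ q → v̂ (combine r t) * g (proj₁ q)) (remQuot-combine r t)) ⟩
  ∑[ t < ℓ ] (v̂ (combine r t) * g r)
    ≡⟨ *-distribʳ-sum (g r) (λ t → v̂ (combine r t)) ⟨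
  ∑[ t < ℓ ] v̂ (combine r t) * g r
    ≡⟨ cong (_* g r) (block-sum ref r) ⟩
  v r * g r
    ∎

-- The `ℓ` unit vectors that make up row `r` of `M` become the `ℓ` rows of block `r`. `M` may be
-- rectangular, since the second application is to an `m` by `m * ℓ` matrix.
refine-rows : ∀ {m n ℓ} (M : Fin m → Fin n → ℕ) → (∀ r → sum (M r) ≡ ℓ) →
              ∃[ M̂ ] (∀ x → sum (M̂ x) ≡ 1) × (∀ c → Refines ℓ (flip M̂ c) (flip M c))
refine-rows {m} {n} {ℓ} M rows = M̂ , (λ x → proj₁ (proj₂ (parts (q x))) (t x)) , M̂-refines
  where
  q : Fin (m * ℓ) → Fin m
  q = quotient ℓ
  t : Fin (m * ℓ) → Fin ℓ
  t = remainder {m} ℓ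
  parts : ∀ r → ∃[ w ] (∀ t → sum (w t) ≡ 1) × (∀ c → ∑[ t < ℓ ] w t c ≡ M r c)
  parts r = split-units ℓ (M r) (rows r)
  M̂ : Fin (m * ℓ) → Fin n → ℕ
  M̂ x = proj₁ (parts (q x)) (t x)
  M̂-refines : ∀ c → Refines ℓ (flip M̂ c) (flip M c)
  M̂-refines c = refines λ r → trans
    (sum-cong-≗ λ t → cong (λ (r , t) → proj₁ (parts r) t c) (remQuot-combine r t))
    (proj₂ (proj₂ (parts r)) c)

-- The last component expresses that the blocks of `D` sum to the entries of `N`, tested against any
-- block-constant weight `g`; with an indicator for `g` it counts cells.
blow-up : ∀ {m ℓ} (N : Fin m → Fin m → ℕ) →
          (∀ r → ∑[ c < m ] N r c ≡ ℓ) → (∀ c → ∑[ r < m ] N r c ≡ ℓ) →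
          ∃[ D ] (∀ x → ∑[ y < m * ℓ ] D x y ≡ 1) × (∀ y → ∑[ x < m * ℓ ] D x y ≡ 1) ×
                 (∀ (g : Fin m → Fin m → ℕ) →
                  ∑[ x < m * ℓ ] ∑[ y < m * ℓ ] (D x y * g (quotient ℓ x) (quotient ℓ y)) ≡
                  ∑[ r < m ] ∑[ c < m ] (N r c * g r c))
blow-up {m} {ℓ} N rows cols =
  let N̂ , N̂-rows , N̂-refines = refine-rows N rows
      -- Refining the rows kept every column sum equal to `ℓ`, so the transpose can be refined in
      -- turn. This `D` is indexed by column first.
      D , D-cols , D-refines = refine-rows (flip N̂) (λ c → trans (refines-sum (N̂-refines c)) (cols c))
  in flip D , (λ x → trans (refines-sum (D-refines x)) (N̂-rows x)) , D-cols , λ g → begin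
    ∑[ x < m * ℓ ] ∑[ y < m * ℓ ] (D y x * g (quotient ℓ x) (quotient ℓ y))
      -- Column blocks are collapsed first; after the sums are exchanged, row blocks are collapsed
      -- in the same way.
      ≡⟨ sum-cong-≗ (λ x → refines-sum (refines-* (D-refines x) (g (quotient ℓ x)))) ⟩
    ∑[ x < m * ℓ ] ∑[ c < m ] (N̂ x c * g (quotient ℓ x) c)
      ≡⟨ ∑-comm (λ x c → N̂ x c * g (quotient ℓ x) c) ⟩
    ∑[ c < m ] ∑[ x < m * ℓ ] (N̂ x c * g (quotient ℓ x) c)
      ≡⟨ sum-cong-≗ (λ c → refines-sum (refines-* (N̂-refines c) (flip g c))) ⟩
    ∑[ c < m ] ∑[ r < m ] (N r c * g r c)
      ≡⟨ ∑-comm (λ r c → N r c * g r c) ⟨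
    ∑[ r < m ] ∑[ c < m ] (N r c * g r c)
      ∎

bit : Bool → ℕ
bit false = 0
bit true  = 1

bit-∧ : ∀ a b → bit (a ∧ b) ≡ bit a * bit b
bit-∧ false b = refl
bit-∧ true  b = sym (*-identityˡ (bit b))

bit-pos : ∀ {n} → n ≤ 1 → bit (0 <ᵇ n) ≡ n
bit-pos z≤n       = refl
bit-pos (s≤s z≤n) = refl

sum-δ : ∀ {n} (v : Vector ℕ n) r → ∑[ i < n ] (v i * bit (does (i ≟ r))) ≡ v r
sum-δ {suc n} v zero = begin
  v zero * 1 + ∑[ i < n ] (v (suc i) * 0)  ≡⟨ cong₂ _+_ (*-identityʳ _) (sum-cong-≗ (*-zeroʳ ∘ tail v)) ⟩
  v zero + ∑[ i < n ] 0                  ≡⟨ cong (v zero +_) (sum-replicate-zero n) ⟩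
  v zero + 0                             ≡⟨ +-identityʳ (v zero) ⟩
  v zero                                 ∎
-- `does (suc i ≟ suc r)` computes to `does (i ≟ r)`, so the induction hypothesis fits as it is.
sum-δ {suc n} v (suc r) = cong₂ _+_ (*-zeroʳ (v zero)) (sum-δ (tail v) r)

length-filter-tabulate : ∀ {A : Set} {P : Pred A 0ℓ} (P? : Decidable P) {n} (f : Fin n → A) →
                         length (filter P? (tabulate f)) ≡ ∑[ i < n ] bit (does (P? (f i)))
length-filter-tabulate P? {zero}  f = refl
length-filter-tabulate P? {suc n} f with does (P? (f zero))
... | true  = cong suc (length-filter-tabulate P? (f ∘ suc))
... | false = length-filter-tabulate P? (f ∘ suc)

length-filter-cartesianProduct :
  ∀ {A B : Set} {P : Pred (A × B) 0ℓ} (P? : Decidable P) {m n} (f : Fin m → A) (g : Fin n → B) →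
  length (filter P? (cartesianProduct (tabulate f) (tabulate g))) ≡
  ∑[ i < m ] ∑[ j < n ] bit (does (P? (f i , g j)))
length-filter-cartesianProduct P? {zero} f g = refl
length-filter-cartesianProduct {A} {B} P? {suc m} {n} f g = begin
  length (filter P? (row ++ rest))
    ≡⟨ cong length (filter-++ P? row rest) ⟩
  length (filter P? row ++ filter P? rest)
    ≡⟨ length-++ (filter P? row) ⟩
  length (filter P? row) + length (filter P? rest)
    ≡⟨ cong₂ _+_
         (trans (cong (length ∘ filter P?) (map-tabulate g (f zero ,_)))
                (length-filter-tabulate P? (λ j → f zero , g j)))
         (length-filter-cartesianProduct P? (f ∘ suc) g) ⟩
  ∑[ i < suc m ] ∑[ j < n ] bit (does (P? (f i , g j)))
    ∎
  where
  row  = map (f zero ,_) (tabulate g)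
  rest = cartesianProduct (tabulate (f ∘ suc)) (tabulate g)

module _ {n} (S : CellSet n) where

  -- Passes from list counts to sums: `does` of the filtering decision computes to a conjunction,
  -- whose `bit` is a product.
  countIn-∑∑ : {P : Pred (Cell n) 0ℓ} (P? : Decidable P) →
               countIn S P? ≡ ∑[ x < n ] ∑[ y < n ] (bit (S (x , y)) * bit (does (P? (x , y))))
  countIn-∑∑ P? = trans
    (length-filter-cartesianProduct _ {n} {n} id id)
    (∑∑-cong λ x y → bit-∧ (S (x , y)) (does (P? (x , y))))

  countIn-row : ∀ r → countIn S (λ x → proj₁ x ≟ r) ≡ ∑[ y < n ] bit (S (r , y))
  countIn-row r = begin
    countIn S (λ x → proj₁ x ≟ r)
      ≡⟨ countIn-∑∑ (λ x → proj₁ x ≟ r) ⟩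
    ∑[ x < n ] ∑[ y < n ] (bit (S (x , y)) * bit (does (x ≟ r)))
      ≡⟨ sum-cong-≗ (λ x → *-distribʳ-sum (bit (does (x ≟ r))) (λ y → bit (S (x , y)))) ⟨
    ∑[ x < n ] (∑[ y < n ] bit (S (x , y)) * bit (does (x ≟ r)))
      ≡⟨ sum-δ (λ x → ∑[ y < n ] bit (S (x , y))) r ⟩
    ∑[ y < n ] bit (S (r , y))
      ∎

  countIn-column : ∀ c → countIn S (λ x → proj₂ x ≟ c) ≡ ∑[ x < n ] bit (S (x , c))
  countIn-column c = trans
    (countIn-∑∑ (λ x → proj₂ x ≟ c))
    (sum-cong-≗ λ x → sum-δ (λ y → bit (S (x , y))) c)

plex⇒balanced : ∀ {m} (L : LatinSquare m) q {k} → HasPlex L k → HasBalancedDiagonal (L ⟨ q * k ⟩)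
plex⇒balanced {m} L q {k} (S , plex) =
  T , record { rows = diag-rows ; columns = diag-columns } , balanced
  where
  open LatinSquare L using (entry)
  open IsPlex plex
  ℓ = q * k

  s : Fin m → Fin m → ℕ
  s r c = bit (S (r , c))

  scale : ∀ {n} (v : Vector ℕ n) → sum v ≡ k → ∑[ i < n ] (q * v i) ≡ ℓ
  scale v eq = trans (sym (*-distribˡ-sum q v)) (cong (q *_) eq)

  -- The factor `q` is the quotient of `ℓ` by `k`; it raises the line sums of the plex indicator
  -- from `k` to `ℓ`.
  N-blow-up = blow-up (λ r c → q * s r c)
    (λ r → scale (s r) (trans (sym (countIn-row S r)) (rows r)))
    (λ c → scale (flip s c) (trans (sym (countIn-column S c)) (columns c)))

  D : Fin (m * ℓ) → Fin (m * ℓ) → ℕ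
  D = proj₁ N-blow-up

  D-rows : ∀ x → ∑[ y < m * ℓ ] D x y ≡ 1
  D-rows = proj₁ (proj₂ N-blow-up)

  T : CellSet (m * ℓ)
  T (x , y) = 0 <ᵇ D x y

  bit-T : ∀ x y → bit (T (x , y)) ≡ D x y
  -- An entry is at most its row sum 1, so testing positivity loses nothing.
  bit-T x y = bit-pos (≤-trans (≤-sum (D x) y) (≤-reflexive (D-rows x)))

  diag-rows : ∀ x → countIn T (λ z → proj₁ z ≟ x) ≡ 1
  diag-rows x = trans (countIn-row T x) (trans (sum-cong-≗ (bit-T x)) (D-rows x))

  diag-columns : ∀ y → countIn T (λ z → proj₂ z ≟ y) ≡ 1
  diag-columns y = trans (countIn-column T y)
    (trans (sum-cong-≗ (flip bit-T y)) (proj₁ (proj₂ (proj₂ N-blow-up)) y))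

  balanced : IsBalanced (L ⟨ ℓ ⟩) T
  balanced e = begin
    countIn T (λ z → uncurry (FrequencySquare.entry (L ⟨ ℓ ⟩)) z ≟ e)
      ≡⟨ countIn-∑∑ T (λ z → uncurry (FrequencySquare.entry (L ⟨ ℓ ⟩)) z ≟ e) ⟩
    ∑[ x < m * ℓ ] ∑[ y < m * ℓ ] (bit (T (x , y)) * isE (quotient ℓ x) (quotient ℓ y))
      ≡⟨ ∑∑-cong (λ x y → cong (_* isE (quotient ℓ x) (quotient ℓ y)) (bit-T x y)) ⟩
    ∑[ x < m * ℓ ] ∑[ y < m * ℓ ] (D x y * isE (quotient ℓ x) (quotient ℓ y))
      -- The symbol in a cell of `L ⟨ ℓ ⟩` depends only on its block, so `isE` is an admissible
      -- weight.
      ≡⟨ proj₂ (proj₂ (proj₂ N-blow-up)) isE ⟩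
    ∑[ r < m ] ∑[ c < m ] (q * s r c * isE r c)
      ≡⟨ ∑∑-cong (λ r c → *-assoc q (s r c) (isE r c)) ⟩
    ∑[ r < m ] ∑[ c < m ] (q * (s r c * isE r c))
      ≡⟨ sum-cong-≗ (λ r → *-distribˡ-sum q (λ c → s r c * isE r c)) ⟨
    ∑[ r < m ] (q * ∑[ c < m ] (s r c * isE r c))
      -- The plex has `k` cells with symbol `e`, here counted row by row.
      ≡⟨ scale (λ r → ∑[ c < m ] (s r c * isE r c)) (trans (sym (countIn-∑∑ S (λ z → uncurry entry z ≟ e))) (entries e)) ⟩
    ℓ ∎
    where
    isE : Fin m → Fin m → ℕ
    isE r c = bit (does (entry r c ≟ e))

theorem11 : ∀ (m : ℕ) → 1 ≤ m → (L : LatinSquare m) →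
    (∀ (ℓ k : ℕ) → 1 ≤ ℓ → 1 ≤ k → HasPlex L k → k ∣ ℓ → HasBalancedDiagonal (L ⟨ ℓ ⟩)) ×
    (HasTransversal L → ∀ (ℓ : ℕ) → 1 ≤ ℓ → HasBalancedDiagonal (L ⟨ ℓ ⟩))
-- A transversal is a 1-plex, and 1 divides every `ℓ`.
theorem11 m _ L = (λ _ _ _ _ → from-plex) , λ transversal ℓ _ → from-plex transversal (1∣ ℓ)
  where
  from-plex : ∀ {ℓ k} → HasPlex L k → k ∣ ℓ → HasBalancedDiagonal (L ⟨ ℓ ⟩)
  from-plex plex (divides q refl) = plex⇒balanced L q plex
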